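{- Consider the canonical negative-positive double Boolean automata circuit $D_{\ell,r}$ (negative left-circuit of size $\ell$, positive right-circuit of size $r$). Let $p\in\mathbb{N}$ be a divisor of $r=p\cdot q$ that does not divide $\ell$, and write $\ell=k\cdot p+d$ with $d=\ell \bmod p$. A configuration $x=x(t)$ has period $p$ if and only if there exists a circular word $w\in\{0,1\}^p$ of size $p$ that does not contain the sub-sequence $0u0$, $u\in\{0,1\}^{d-1}$, and that satisfies $$x^L = w^k\,w[0\ldots d-1]\qquad\text{and}\qquad x^R=w^q ,$$ where $w[0\ldots m]=w_0\ldots w_m$. More precisely, the word $w$ satisfies $$\forall i<p,\quad w_i=x_0(t+i).$$ Consequently, the property for a configuration to be of period $p$ depends only on $d=\ell\bmod p$ and on $p$ (and not on $\ell$ nor on $r$).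
   Context: The canonical negative-positive double Boolean automata circuit $D_{\ell,r}$ has $n=\ell+r-1$ nodes $0,\ldots,n-1$. For a configuration $x=(x_0,\ldots,x_{n-1})\in\{0,1\}^n$ write $x^L=(x_0,\ldots,x_{\ell-1})$ (states of the left-circuit) and $x^R=(x_0,x_\ell,\ldots,x_{n-1})$ (states of the right-circuit, $r$ entries). All nodes are updated in parallel by $F:\{0,1\}^n\to\{0,1\}^n$: $F(x)_i=x_{i-1}$ for $i\notin\{0,\ell\}$; $F(x)_\ell=x_0$; and $F(x)_0=\neg x_{\ell-1}\vee x_{n-1}$. A trajectory is given by $x(t+1)=F(x(t))$, and $x_0(t+i)$ denotes the state of node $0$ in $x(t+i)=F^i(x(t))$. A configuration $x(t)$ has period $p$ if $x(t+m\cdot p)=x(t)$ for all $m\in\mathbb{N}$; $p$ need not be minimal. For a word $w$, $w^k$ is the $k$-fold concatenation of $w$. A circular word $w=w_0\ldots w_{p-1}$ contains $0u0$ for some $u\in\{0,1\}^{d-1}$ iff there is an index $i$ with $w_i=w_{(i+d)\bmod p}=0$.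
   Formalization: The clause w_i = x_0(t+i) is stated as w_{ -i mod p} = x_0(t+i) for i<p: as written it fails for ℓ=1, r=p=3, x=110, where w=110 but x_0(t+1)=0, because the word runs backwards in time. -}

module Defs where

open import Data.Bool using (Bool; true; false; not; _∨_; if_then_else_)
open import Data.Fin using (Fin; zero; suc; toℕ; fromℕ<; inject≤; pred)
open import Data.Fin.Properties using (toℕ<n)
open import Data.List using (List; _++_; concat; replicate; take)
open import Data.Nat
  using (ℕ; zero; suc; _+_; _*_; _∸_; _≤_; _<_; NonZero; _≟_; >-nonZero⁻¹)
open import Data.Nat.DivMod using (_mod_)
open import Data.Nat.GeneralisedArithmetic using (fold)
open import Data.Nat.Properties using (+-suc; m≤m+n; +-monoʳ-<; ≤-trans; ≤-refl)
open import Data.Product using (_×_; ∃-syntax)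
open import Data.Vec using (Vec; lookup; tabulate; toList)
open import Relation.Binary.PropositionalEquality using (_≡_; sym; subst)
open import Relation.Nullary.Decidable using (⌊_⌋)

size : ℕ → ℕ → ℕ
size ℓ r = ℓ + r ∸ 1

Config : ℕ → ℕ → Set
Config ℓ r = Vec Bool (size ℓ r)

ℓ≤size : ∀ ℓ r .{{_ : NonZero r}} → ℓ ≤ size ℓ r
ℓ≤size ℓ (suc r) = subst (λ m → ℓ ≤ m ∸ 1) (sym (+-suc ℓ r)) (m≤m+n ℓ r)

∸1-< : ∀ {n} → 0 < n → n ∸ 1 < n
∸1-< {suc n} _ = ≤-refl

module _ (ℓ r : ℕ) .{{_ : NonZero ℓ}} .{{_ : NonZero r}} where

  0<size : 0 < size ℓ r
  0<size = ≤-trans (>-nonZero⁻¹ ℓ) (ℓ≤size ℓ r)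

  node₀ : Fin (size ℓ r)
  node₀ = fromℕ< 0<size

  leftNode : Fin ℓ → Fin (size ℓ r)
  leftNode i = inject≤ i (ℓ≤size ℓ r)

  node[ℓ-1] : Fin (size ℓ r)
  node[ℓ-1] = leftNode (fromℕ< (∸1-< (>-nonZero⁻¹ ℓ)))

  node[n-1] : Fin (size ℓ r)
  node[n-1] = fromℕ< (∸1-< 0<size)

  F : Config ℓ r → Config ℓ r
  F x = tabulate λ i →
    if ⌊ toℕ i ≟ 0 ⌋ then not (lookup x node[ℓ-1]) ∨ lookup x node[n-1]
    else if ⌊ toℕ i ≟ ℓ ⌋ then lookup x node₀
    else lookup x (pred i)

  trajectory : Config ℓ r → ℕ → Config ℓ r
  trajectory x t = fold x F t

  -- The period p need not be minimal.
  HasPeriod : ℕ → Config ℓ r → Set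
  HasPeriod p x = ∀ m → trajectory x (m * p) ≡ x

  leftStates : Config ℓ r → Vec Bool ℓ
  leftStates x = tabulate λ i → lookup x (leftNode i)

rightNode : ∀ ℓ r .{{_ : NonZero ℓ}} → Fin r → Fin (size ℓ r)
rightNode ℓ (suc r) zero    = node₀ ℓ (suc r)
rightNode ℓ (suc r) (suc j) =
  fromℕ< (subst (λ m → ℓ + toℕ j < m ∸ 1) (sym (+-suc ℓ r)) (+-monoʳ-< ℓ (toℕ<n j)))

rightStates : ∀ ℓ r .{{_ : NonZero ℓ}} → Config ℓ r → Vec Bool r
rightStates ℓ r x = tabulate λ j → lookup x (rightNode ℓ r j)

infixr 8 _^ʷ_
_^ʷ_ : ∀ {A : Set} → List A → ℕ → List A
w ^ʷ k = concat (replicate k w)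

module _ {p : ℕ} .{{_ : NonZero p}} where

  infixl 9 _‼_
  _‼_ : Vec Bool p → ℕ → Bool
  w ‼ i = lookup w (i mod p)

  Contains0u0 : ℕ → Vec Bool p → Set
  Contains0u0 d w = ∃[ i ] (lookup w i ≡ false × w ‼ (toℕ i + d) ≡ false)

-- x^L = w^k w[0…d-1] and x^R = w^q, compared as lists since the lengths agree
-- only when ℓ = k p + d and r = p q.
SpelledBy : ∀ ℓ r .{{_ : NonZero ℓ}} .{{_ : NonZero r}} →
            ∀ {p} (k d q : ℕ) → Vec Bool p → Config ℓ r → Set
SpelledBy ℓ r k d q w x =
  toList (leftStates ℓ r x) ≡ toList w ^ʷ k ++ take d (toList w) ×
  toList (rightStates ℓ r x) ≡ toList w ^ʷ q

-- w₋ᵢ = x₀(t+i) for all i < p, with indices modulo p.  The word runs backwards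
-- in time: states move away from node 0, so xᵢ(t) is the state that node 0 had
-- i steps before t, whereas the words x^L and x^R are read away from node 0.
-- With wᵢ in place of w₋ᵢ the property fails: for ℓ = 1 and r = p = 3 the
-- configuration 110 has period 3 and x^R = 110, but x₀ takes the values 1, 0, 1.
ReadsNode₀ : ∀ ℓ r .{{_ : NonZero ℓ}} .{{_ : NonZero r}} →
             ∀ {p} .{{_ : NonZero p}} → Vec Bool p → Config ℓ r → Set
ReadsNode₀ ℓ r {p} w x =
  ∀ (i : Fin p) → w ‼ (p ∸ toℕ i) ≡ lookup (trajectory ℓ r x (toℕ i)) (node₀ ℓ r)

{-# OPTIONS --safe #-}
module Submission where

-- States move away from node 0 along both circuits, so one step of F turns the
-- infinite word f spelled by x into f shifted by -1, that is by p - 1 when f is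
-- p-periodic, provided that F gives node 0 the state f(p - 1). Both circuits end
-- at node 0, at indices congruent to d - 1 and to -1 modulo p, so this asks for
-- ¬ f(d - 1) ∨ f(- 1) = f(- 1), which fails only on a factor 0u0. After p steps the
-- shift is a multiple of p, hence trivial. Conversely, if x has period p, it is
-- spelled by f(i) = x₀((p - 1) i), and x₀(t) = 0 forces x₀(t + ℓ) = 1.

open import Defs
open import Data.Bool using (Bool; true; false; not; _∨_; if_then_else_)
open import Data.Bool.Properties using (∨-zeroʳ)
open import Data.Fin using (Fin; zero; suc; toℕ; fromℕ<; inject₁; pred)
open import Data.Fin.Properties
  using (toℕ-injective; toℕ-inject≤; toℕ-fromℕ<; toℕ-inject₁; toℕ<n)
open import Data.List using (_∷_; _++_; take; applyUpTo)
open import Data.List.Properties using (∷-injective)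
open import Data.Nat
  using (ℕ; zero; suc; _+_; _*_; _∸_; _≤_; _<_; NonZero; _≟_; _<?_;
         s≤s; z≤n; s<s; z<s; ≢-nonZero⁻¹; >-nonZero⁻¹)
open import Data.Nat.DivMod
  using (_%_; _/_; _mod_; m%n<n; m≡m%n+[m/n]*n; [m+n]%n≡m%n; m<n⇒m%n≡m)
open import Data.Nat.Divisibility using (_∣_; 1∣_)
open import Data.Nat.GeneralisedArithmetic using (fold-+)
open import Data.Nat.Properties
open import Data.Nat.Tactic.RingSolver using (solve-∀)
open import Data.Product using (_×_; _,_; ∃-syntax; proj₁; proj₂)
open import Data.Sum using (_⊎_; inj₁; inj₂)
open import Data.Vec using (Vec; lookup; tabulate; toList)
open import Data.Vec.Properties using (lookup∘tabulate; tabulate∘lookup; tabulate-cong)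
open import Function using (_∘_; it)
open import Function.Construct.Composition using (_⇔-∘_)
open import Function.Construct.Symmetry using (⇔-sym)
open import Function.Bundles using (_⇔_; mk⇔; Equivalence)
open import Relation.Binary.PropositionalEquality
  using (_≡_; _≢_; _≗_; refl; sym; trans; cong; cong₂; subst; module ≡-Reasoning)
open import Relation.Nullary using (¬_; yes; no; contradiction)
open import Relation.Nullary.Decidable using (⌊_⌋)

open Equivalence using (to; from)

module _ {A : Set} where

  applyUpTo-cong : ∀ {f g : ℕ → A} → f ≗ g → applyUpTo f ≗ applyUpTo g
  applyUpTo-cong f≗g zero    = refl
  applyUpTo-cong f≗g (suc n) = cong₂ _∷_ (f≗g 0) (applyUpTo-cong (f≗g ∘ suc) n)

  applyUpTo-+ : ∀ (f : ℕ → A) m n →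
    applyUpTo f (m + n) ≡ applyUpTo f m ++ applyUpTo (f ∘ (m +_)) n
  applyUpTo-+ f zero    n = refl
  applyUpTo-+ f (suc m) n = cong (f 0 ∷_) (applyUpTo-+ (f ∘ suc) m n)

  take-applyUpTo : ∀ (f : ℕ → A) {m n} → m ≤ n → take m (applyUpTo f n) ≡ applyUpTo f m
  take-applyUpTo f z≤n       = refl
  take-applyUpTo f (s≤s m≤n) = cong (f 0 ∷_) (take-applyUpTo (f ∘ suc) m≤n)

  toList-tabulate⁺ : ∀ (f : ℕ → A) {n} {g : Fin n → A} →
    (∀ i → g i ≡ f (toℕ i)) → toList (tabulate g) ≡ applyUpTo f n
  toList-tabulate⁺ f {zero}  g≗f = refl
  toList-tabulate⁺ f {suc n} g≗f =
    cong₂ _∷_ (g≗f zero) (toList-tabulate⁺ (f ∘ suc) (g≗f ∘ suc))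

  toList-tabulate⁻ : ∀ (f : ℕ → A) {n} {g : Fin n → A} →
    toList (tabulate g) ≡ applyUpTo f n → ∀ i → g i ≡ f (toℕ i)
  toList-tabulate⁻ f eq zero    = proj₁ (∷-injective eq)
  toList-tabulate⁻ f eq (suc i) = toList-tabulate⁻ (f ∘ suc) (proj₂ (∷-injective eq)) i

  Periodic : ℕ → (ℕ → A) → Set
  Periodic p f = ∀ i → f (i + p) ≡ f i

  module _ {p : ℕ} {f : ℕ → A} (periodic : Periodic p f) where

    periodic-* : ∀ m i → f (i + m * p) ≡ f i
    periodic-* zero    i = cong f (+-identityʳ i)
    periodic-* (suc m) i = begin
      f (i + (p + m * p)) ≡⟨ cong f (+-assoc i p (m * p)) ⟨
      f (i + p + m * p)   ≡⟨ periodic-* m (i + p) ⟩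
      f (i + p)           ≡⟨ periodic i ⟩
      f i                 ∎
      where open ≡-Reasoning

    periodic-≡ : ∀ a b {i j} → i + a * p ≡ j + b * p → f i ≡ f j
    periodic-≡ a b {i} {j} eq =
      trans (sym (periodic-* a i)) (trans (cong f eq) (periodic-* b j))

    periodic-% : .{{_ : NonZero p}} → ∀ i → f i ≡ f (i % p)
    periodic-% i = trans (cong f (m≡m%n+[m/n]*n i p)) (periodic-* (i / p) (i % p))

    applyUpTo-^ʷ : ∀ k → applyUpTo f p ^ʷ k ≡ applyUpTo f (k * p)
    applyUpTo-^ʷ zero    = refl
    applyUpTo-^ʷ (suc k) = begin
      applyUpTo f p ++ applyUpTo f p ^ʷ k                ≡⟨ cong (applyUpTo f p ++_) (applyUpTo-^ʷ k) ⟩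
      applyUpTo f p ++ applyUpTo f (k * p)               ≡⟨ cong (applyUpTo f p ++_) (applyUpTo-cong shift (k * p)) ⟩
      applyUpTo f p ++ applyUpTo (f ∘ (p +_)) (k * p)    ≡⟨ applyUpTo-+ f p (k * p) ⟨
      applyUpTo f (p + k * p)                            ∎
      where
      open ≡-Reasoning
      shift : f ≗ f ∘ (p +_)
      shift i = trans (sym (periodic i)) (cong f (+-comm i p))

    applyUpTo-^ʷ-take : ∀ k {d} → d ≤ p →
      applyUpTo f p ^ʷ k ++ take d (applyUpTo f p) ≡ applyUpTo f (k * p + d)
    applyUpTo-^ʷ-take k {d} d≤p = begin
      applyUpTo f p ^ʷ k ++ take d (applyUpTo f p)           ≡⟨ cong₂ _++_ (applyUpTo-^ʷ k) (take-applyUpTo f d≤p) ⟩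
      applyUpTo f (k * p) ++ applyUpTo f d                   ≡⟨ cong (applyUpTo f (k * p) ++_) (applyUpTo-cong shift d) ⟩
      applyUpTo f (k * p) ++ applyUpTo (f ∘ (k * p +_)) d    ≡⟨ applyUpTo-+ f (k * p) d ⟨
      applyUpTo f (k * p + d)                                ∎
      where
      open ≡-Reasoning
      shift : f ≗ f ∘ (k * p +_)
      shift i = trans (sym (periodic-* k i)) (cong f (+-comm i (k * p)))

Avoids0u0 : ℕ → (ℕ → Bool) → Set
Avoids0u0 d f = ∀ i → ¬ (f i ≡ false × f (i + d) ≡ false)

module _ {p : ℕ} .{{_ : NonZero p}} where

  toℕ-mod : ∀ i → toℕ (i mod p) ≡ i % p
  toℕ-mod i = toℕ-fromℕ< (m%n<n i p)

  ‼-periodic : ∀ (w : Vec Bool p) → Periodic p (w ‼_)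
  ‼-periodic w i = cong (lookup w) (toℕ-injective
    (trans (toℕ-mod (i + p)) (trans ([m+n]%n≡m%n i p) (sym (toℕ-mod i)))))

  ‼-toℕ : ∀ (w : Vec Bool p) i → w ‼ toℕ i ≡ lookup w i
  ‼-toℕ w i = cong (lookup w)
    (toℕ-injective (trans (toℕ-mod (toℕ i)) (m<n⇒m%n≡m (toℕ<n i))))

  tabulate-‼ : ∀ {f : ℕ → Bool} → Periodic p f → tabulate (f ∘ toℕ) ‼_ ≗ f
  tabulate-‼ {f} periodic i = begin
    tabulate (f ∘ toℕ) ‼ i ≡⟨ lookup∘tabulate (f ∘ toℕ) (i mod p) ⟩
    f (toℕ (i mod p))      ≡⟨ cong f (toℕ-mod i) ⟩
    f (i % p)              ≡⟨ periodic-% periodic i ⟨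
    f i                    ∎
    where open ≡-Reasoning

  toList-‼ : ∀ (w : Vec Bool p) → toList w ≡ applyUpTo (w ‼_) p
  toList-‼ w = trans (cong toList (sym (tabulate∘lookup w)))
    (toList-tabulate⁺ (w ‼_) (sym ∘ ‼-toℕ w))

  ¬contains⇔avoids : ∀ {d} (w : Vec Bool p) → (¬ Contains0u0 d w) ⇔ Avoids0u0 d (w ‼_)
  ¬contains⇔avoids {d} w = mk⇔ avoids
    λ avoids (i , wᵢ , wᵢ₊ᵈ) → avoids (toℕ i) (trans (‼-toℕ w i) wᵢ , wᵢ₊ᵈ)
    where
    avoids : ¬ Contains0u0 d w → Avoids0u0 d (w ‼_)
    avoids free i (wᵢ , wᵢ₊ᵈ) = free (i mod p , wᵢ , trans (periodic-≡ (‼-periodic w) (i / p) 0 eq) wᵢ₊ᵈ)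
      where
      open ≡-Reasoning
      rearrange : ∀ a b c → a + b + c ≡ a + c + b + 0
      rearrange = solve-∀
      eq : toℕ (i mod p) + d + i / p * p ≡ i + d + 0
      eq = begin
        toℕ (i mod p) + d + i / p * p ≡⟨ cong (λ m → m + d + i / p * p) (toℕ-mod i) ⟩
        i % p + d + i / p * p         ≡⟨ rearrange (i % p) d (i / p * p) ⟩
        i % p + i / p * p + d + 0     ≡⟨ cong (λ m → m + d + 0) (m≡m%n+[m/n]*n i p) ⟨
        i + d + 0                     ∎

lookup-injective : ∀ {A : Set} {n} {x y : Vec A n} → lookup x ≗ lookup y → x ≡ y
lookup-injective {x = x} {y} eq =
  trans (sym (tabulate∘lookup x)) (trans (tabulate-cong eq) (tabulate∘lookup y))

size-suc : ∀ ℓ r → size ℓ (suc r) ≡ ℓ + r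
size-suc ℓ r = cong (_∸ 1) (+-suc ℓ r)

-- The common shape of the two circuits: both run through node 0 and then copy
-- the state of the preceding node.
record IsPath (ℓ r : ℕ) .{{_ : NonZero ℓ}} .{{_ : NonZero r}}
              {m : ℕ} (c : Fin m → Fin (size ℓ r)) : Set where
  field
    start : ∀ i → toℕ i ≡ 0 → c i ≡ node₀ ℓ r
    step  : ∀ x i j → toℕ i ≡ suc (toℕ j) → lookup (F ℓ r x) (c i) ≡ lookup x (c j)

open IsPath

Along : ∀ {n m} → (Fin m → Fin n) → (ℕ → Bool) → Vec Bool n → Set
Along c f x = ∀ i → lookup x (c i) ≡ f (toℕ i)

last : ∀ m .{{_ : NonZero m}} → Fin m
last m = fromℕ< (∸1-< (>-nonZero⁻¹ m))

toℕ-last : ∀ m .{{_ : NonZero m}} → toℕ (last m) ≡ m ∸ 1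
toℕ-last m = toℕ-fromℕ< (∸1-< (>-nonZero⁻¹ m))

module _ (ℓ r : ℕ) .{{_ : NonZero ℓ}} .{{_ : NonZero r}} where

  toℕ-node₀ : toℕ (node₀ ℓ r) ≡ 0
  toℕ-node₀ = toℕ-fromℕ< (0<size ℓ r)

  toℕ-leftNode : ∀ i → toℕ (leftNode ℓ r i) ≡ toℕ i
  toℕ-leftNode i = toℕ-inject≤ i (ℓ≤size ℓ r)

  lookup-F : ∀ x i → lookup (F ℓ r x) i ≡
    (if ⌊ toℕ i ≟ 0 ⌋ then not (lookup x (node[ℓ-1] ℓ r)) ∨ lookup x (node[n-1] ℓ r)
     else if ⌊ toℕ i ≟ ℓ ⌋ then lookup x (node₀ ℓ r)
     else lookup x (pred i))
  lookup-F x = lookup∘tabulate _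

  lookup-F-node₀ : ∀ x → lookup (F ℓ r x) (node₀ ℓ r) ≡
    not (lookup x (node[ℓ-1] ℓ r)) ∨ lookup x (node[n-1] ℓ r)
  lookup-F-node₀ x rewrite lookup-F x (node₀ ℓ r) | toℕ-node₀ = refl

  lookup-F-ℓ : ∀ x i → toℕ i ≡ ℓ → lookup (F ℓ r x) i ≡ lookup x (node₀ ℓ r)
  lookup-F-ℓ x i eq rewrite lookup-F x i
    with toℕ i ≟ 0 | toℕ i ≟ ℓ
  ... | yes i≡0 | _      = contradiction (trans (sym eq) i≡0) (≢-nonZero⁻¹ ℓ)
  ... | no _    | yes _  = refl
  ... | no _    | no i≢ℓ = contradiction eq i≢ℓ

  lookup-F-suc : ∀ x i j → toℕ i ≡ suc (toℕ j) → toℕ i ≢ ℓ → lookup (F ℓ r x) i ≡ lookup x j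
  lookup-F-suc x i j eq i≢ℓ rewrite lookup-F x i
    with toℕ i ≟ 0 | toℕ i ≟ ℓ
  ... | yes i≡0 | _       = contradiction (trans (sym eq) i≡0) λ ()
  ... | no _    | yes i≡ℓ = contradiction i≡ℓ i≢ℓ
  ... | no _    | no _    = cong (lookup x) (pred-suc i j eq)
    where
    pred-suc : ∀ {n} (i j : Fin n) → toℕ i ≡ suc (toℕ j) → pred i ≡ j
    pred-suc (suc i) j eq = toℕ-injective (trans (toℕ-inject₁ i) (suc-injective eq))

  leftNode-isPath : IsPath ℓ r (leftNode ℓ r)
  leftNode-isPath .start i i≡0 =
    toℕ-injective (trans (toℕ-leftNode i) (trans i≡0 (sym toℕ-node₀)))
  leftNode-isPath .step x i j eq = lookup-F-suc x _ _
    (trans (toℕ-leftNode i) (trans eq (cong suc (sym (toℕ-leftNode j)))))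
    λ i≡ℓ → <⇒≢ (toℕ<n i) (trans (sym (toℕ-leftNode i)) i≡ℓ)

toℕ-rightNode-suc : ∀ ℓ r .{{_ : NonZero ℓ}} (j : Fin r) →
  toℕ (rightNode ℓ (suc r) (suc j)) ≡ ℓ + toℕ j
toℕ-rightNode-suc ℓ r j = toℕ-fromℕ<
  (subst (λ m → ℓ + toℕ j < m ∸ 1) (sym (+-suc ℓ r)) (+-monoʳ-< ℓ (toℕ<n j)))

toℕ-rightNode-last : ∀ ℓ r .{{_ : NonZero ℓ}} .{{_ : NonZero r}} → 1 < r →
  toℕ (rightNode ℓ r (last r)) ≡ size ℓ r ∸ 1
toℕ-rightNode-last ℓ (suc zero) (s≤s ())
toℕ-rightNode-last ℓ (suc (suc r)) _ = begin
  toℕ (rightNode ℓ (2 + r) (suc (last (suc r)))) ≡⟨ toℕ-rightNode-suc ℓ (suc r) (last (suc r)) ⟩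
  ℓ + toℕ (last (suc r))                         ≡⟨ cong (ℓ +_) (toℕ-last (suc r)) ⟩
  ℓ + r                                          ≡⟨ cong (_∸ 1) (+-suc ℓ r) ⟨
  ℓ + suc r ∸ 1                                  ≡⟨ cong (_∸ 1) (size-suc ℓ (suc r)) ⟨
  size ℓ (2 + r) ∸ 1                             ∎
  where open ≡-Reasoning

rightNode-isPath : ∀ ℓ r .{{_ : NonZero ℓ}} .{{_ : NonZero r}} → IsPath ℓ r (rightNode ℓ r)
rightNode-isPath ℓ (suc r) .start zero _ = refl
rightNode-isPath ℓ (suc r) .step x (suc i) zero eq = lookup-F-ℓ ℓ (suc r) x _
  (trans (toℕ-rightNode-suc ℓ r i) (trans (cong (ℓ +_) (suc-injective eq)) (+-identityʳ ℓ)))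
rightNode-isPath ℓ (suc r) .step x (suc i) (suc j) eq = lookup-F-suc ℓ (suc r) x _ _
  (begin
    toℕ (rightNode ℓ (suc r) (suc i))       ≡⟨ toℕ-rightNode-suc ℓ r i ⟩
    ℓ + toℕ i                               ≡⟨ cong (ℓ +_) (suc-injective eq) ⟩
    ℓ + suc (toℕ j)                         ≡⟨ +-suc ℓ (toℕ j) ⟩
    suc (ℓ + toℕ j)                         ≡⟨ cong suc (toℕ-rightNode-suc ℓ r j) ⟨
    suc (toℕ (rightNode ℓ (suc r) (suc j))) ∎)
  λ i≡ℓ → m+1+n≢m ℓ (trans (cong (ℓ +_) (sym (suc-injective eq)))
                           (trans (sym (toℕ-rightNode-suc ℓ r i)) i≡ℓ))
  where open ≡-Reasoning

node-cases : ∀ ℓ r .{{_ : NonZero ℓ}} .{{_ : NonZero r}} (i : Fin (size ℓ r)) →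
  (∃[ j ] i ≡ leftNode ℓ r j) ⊎ (∃[ j ] i ≡ rightNode ℓ r j)
node-cases ℓ (suc r) i with toℕ i <? ℓ
... | yes i<ℓ = inj₁ (fromℕ< i<ℓ , toℕ-injective
  (sym (trans (toℕ-leftNode ℓ (suc r) _) (toℕ-fromℕ< i<ℓ))))
... | no i≮ℓ = inj₂ (suc (fromℕ< i∸ℓ<r) , toℕ-injective (begin
    toℕ i                                             ≡⟨ m+[n∸m]≡n (≮⇒≥ i≮ℓ) ⟨
    ℓ + (toℕ i ∸ ℓ)                                   ≡⟨ cong (ℓ +_) (toℕ-fromℕ< i∸ℓ<r) ⟨
    ℓ + toℕ (fromℕ< i∸ℓ<r)                            ≡⟨ toℕ-rightNode-suc ℓ r _ ⟨
    toℕ (rightNode ℓ (suc r) (suc (fromℕ< i∸ℓ<r)))    ∎))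
  where
  open ≡-Reasoning
  i∸ℓ<r : toℕ i ∸ ℓ < r
  i∸ℓ<r = +-cancelˡ-< ℓ _ _ (subst (_< ℓ + r) (sym (m+[n∸m]≡n (≮⇒≥ i≮ℓ)))
    (subst (toℕ i <_) (size-suc ℓ r) (toℕ<n i)))

module _ (ℓ r : ℕ) .{{_ : NonZero ℓ}} .{{_ : NonZero r}} where

  infixr 4 _,_
  record Spells (f : ℕ → Bool) (x : Config ℓ r) : Set where
    constructor _,_
    field
      onLeft  : Along (leftNode ℓ r) f x
      onRight : Along (rightNode ℓ r) f x

  spells-cong : ∀ {f g x} → f ≗ g → Spells f x → Spells g x
  spells-cong f≗g (left , right) =
    (λ i → trans (left i) (f≗g (toℕ i))) , λ i → trans (right i) (f≗g (toℕ i))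

  spells-injective : ∀ {f x y} → Spells f x → Spells f y → x ≡ y
  spells-injective {f} {x} {y} (leftˣ , rightˣ) (leftʸ , rightʸ) = lookup-injective agree
    where
    agree : lookup x ≗ lookup y
    agree i with node-cases ℓ r i
    ... | inj₁ (j , refl) = trans (leftˣ j) (sym (leftʸ j))
    ... | inj₂ (j , refl) = trans (rightˣ j) (sym (rightʸ j))

  spells-node₀ : ∀ {f x} → Spells f x → lookup x (node₀ ℓ r) ≡ f 0
  spells-node₀ {f} {x} (left , _) = begin
    lookup x (node₀ ℓ r)                     ≡⟨ cong (lookup x) (leftNode-isPath ℓ r .start i toℕ-i) ⟨
    lookup x (leftNode ℓ r i)                ≡⟨ left i ⟩
    f (toℕ i)                                ≡⟨ cong f toℕ-i ⟩
    f 0                                      ∎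
    where
    open ≡-Reasoning
    i : Fin ℓ
    i = fromℕ< (>-nonZero⁻¹ ℓ)
    toℕ-i : toℕ i ≡ 0
    toℕ-i = toℕ-fromℕ< (>-nonZero⁻¹ ℓ)

open Spells

spells-exists : ∀ ℓ r .{{_ : NonZero ℓ}} .{{_ : NonZero r}} (f : ℕ → Bool) → ∃[ x ] Spells ℓ r f x
spells-exists ℓ r f = tabulate (f ∘ distance ∘ toℕ) ,
  (λ i → trans (lookup∘tabulate _ (leftNode ℓ r i)) (cong f (distance-leftNode i))) ,
  (λ i → trans (lookup∘tabulate _ (rightNode ℓ r i)) (cong f (distance-rightNode r i)))
  where
  distance : ℕ → ℕ
  distance m = if ⌊ m <? ℓ ⌋ then m else suc (m ∸ ℓ)

  distance-< : ∀ {m} → m < ℓ → distance m ≡ m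
  distance-< {m} m<ℓ with m <? ℓ
  ... | yes _  = refl
  ... | no m≮ℓ = contradiction m<ℓ m≮ℓ

  distance-+ : ∀ m → distance (ℓ + m) ≡ suc m
  distance-+ m with ℓ + m <? ℓ
  ... | yes <ℓ = contradiction <ℓ (m+n≮m ℓ m)
  ... | no  _  = cong suc (m+n∸m≡n ℓ m)

  distance-leftNode : ∀ i → distance (toℕ (leftNode ℓ r i)) ≡ toℕ i
  distance-leftNode i =
    trans (cong distance (toℕ-leftNode ℓ r i)) (distance-< (toℕ<n i))

  distance-rightNode : ∀ r .{{_ : NonZero r}} i → distance (toℕ (rightNode ℓ r i)) ≡ toℕ i
  distance-rightNode (suc r) zero    =
    trans (cong distance (toℕ-node₀ ℓ (suc r))) (distance-< (>-nonZero⁻¹ ℓ))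
  distance-rightNode (suc r) (suc i) =
    trans (cong distance (toℕ-rightNode-suc ℓ r i)) (distance-+ (toℕ i))

spelledBy⇔spells : ∀ ℓ r .{{_ : NonZero ℓ}} .{{_ : NonZero r}} {p} .{{_ : NonZero p}} k {d} q →
  d ≤ p → r ≡ p * q → ℓ ≡ k * p + d → ∀ {w : Vec Bool p} {x} →
  SpelledBy ℓ r k d q w x ⇔ Spells ℓ r (w ‼_) x
spelledBy⇔spells ℓ r {p} k {d} q d≤p r≡ ℓ≡ {w} {x} = mk⇔
  (λ (left , right) → toList-tabulate⁻ (w ‼_) (trans left leftWord) ,
                      toList-tabulate⁻ (w ‼_) (trans right rightWord))
  (λ (left , right) → trans (toList-tabulate⁺ (w ‼_) left) (sym leftWord) ,
                      trans (toList-tabulate⁺ (w ‼_) right) (sym rightWord))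
  where
  leftWord : toList w ^ʷ k ++ take d (toList w) ≡ applyUpTo (w ‼_) ℓ
  leftWord rewrite toList-‼ w =
    trans (applyUpTo-^ʷ-take (‼-periodic w) k d≤p) (cong (applyUpTo (w ‼_)) (sym ℓ≡))

  rightWord : toList w ^ʷ q ≡ applyUpTo (w ‼_) r
  rightWord rewrite toList-‼ w =
    trans (applyUpTo-^ʷ (‼-periodic w) q) (cong (applyUpTo (w ‼_)) (trans (*-comm q p) (sym r≡)))

-- Adding s is going back by one modulo p = suc s, without truncated subtraction.
module _ (ℓ r : ℕ) .{{_ : NonZero ℓ}} .{{_ : NonZero r}} {s : ℕ} where

  private
    p = suc s
    traj = trajectory ℓ r

  F-along : ∀ {m} {c : Fin m → Fin (size ℓ r)} → IsPath ℓ r c → ∀ {f x} → Periodic p f →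
    lookup (F ℓ r x) (node₀ ℓ r) ≡ f s → Along c f x → Along c (λ i → f (i + s)) (F ℓ r x)
  F-along isPath {x = x} periodic eq along zero =
    trans (cong (lookup (F ℓ r x)) (isPath .start zero refl)) eq
  F-along {c = c} isPath {f} {x} periodic eq along (suc i) = begin
    lookup (F ℓ r x) (c (suc i)) ≡⟨ isPath .step x (suc i) (inject₁ i) (cong suc (sym (toℕ-inject₁ i))) ⟩
    lookup x (c (inject₁ i))     ≡⟨ along (inject₁ i) ⟩
    f (toℕ (inject₁ i))          ≡⟨ cong f (toℕ-inject₁ i) ⟩
    f (toℕ i)                    ≡⟨ periodic (toℕ i) ⟨
    f (toℕ i + suc s)            ≡⟨ cong f (+-suc (toℕ i) s) ⟩
    f (suc (toℕ i) + s)          ∎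
    where open ≡-Reasoning

  trajectory-along : ∀ {m} {c : Fin m → Fin (size ℓ r)} → IsPath ℓ r c → ∀ x t n i → toℕ i ≡ n →
    lookup (traj x (n + t)) (c i) ≡ lookup (traj x t) (node₀ ℓ r)
  trajectory-along isPath x t zero    i       eq = cong (lookup (traj x t)) (isPath .start i eq)
  trajectory-along isPath x t (suc n) (suc i) eq = trans
    (isPath .step (traj x (n + t)) (suc i) (inject₁ i) (cong suc (sym (toℕ-inject₁ i))))
    (trajectory-along isPath x t n (inject₁ i) (trans (toℕ-inject₁ i) (suc-injective eq)))

  trajectory-periodic : ∀ {x} → HasPeriod ℓ r p x → ∀ m t → traj x (t + m * p) ≡ traj x t
  trajectory-periodic {x} period m t = trans (fold-+ x (F ℓ r) t)
    (cong (λ y → traj y t) (period m))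

  backward : Config ℓ r → ℕ → Bool
  backward x i = lookup (traj x (i * s)) (node₀ ℓ r)

  module _ {x} (period : HasPeriod ℓ r p x) where

    backward-≡ : ∀ a b {t u} → t + a * p ≡ u + b * p → traj x t ≡ traj x u
    backward-≡ a b {t} {u} eq = trans (sym (trajectory-periodic period a t))
      (trans (cong (traj x) eq) (trajectory-periodic period b u))

    backward-periodic : Periodic p (backward x)
    backward-periodic i = cong (λ y → lookup y (node₀ ℓ r)) (backward-≡ 0 s (eq i s))
      where
      eq : ∀ i s → (i + suc s) * s + 0 ≡ i * s + s * suc s
      eq = solve-∀

    backward-along : ∀ {m} {c : Fin m → Fin (size ℓ r)} → IsPath ℓ r c → Along c (backward x) x
    backward-along {c = c} isPath i = begin
      lookup x (c i)                            ≡⟨ cong (λ y → lookup y (c i)) (period (toℕ i)) ⟨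
      lookup (traj x (toℕ i * suc s)) (c i)     ≡⟨ cong (λ t → lookup (traj x t) (c i)) (*-suc (toℕ i) s) ⟩
      lookup (traj x (toℕ i + toℕ i * s)) (c i) ≡⟨ trajectory-along isPath x (toℕ i * s) (toℕ i) i refl ⟩
      backward x (toℕ i)                        ∎
      where open ≡-Reasoning

    backward-spells : Spells ℓ r (backward x) x
    backward-spells = backward-along (leftNode-isPath ℓ r) , backward-along (rightNode-isPath ℓ r)

    backward-avoids : ∀ k {d} → ℓ ≡ k * p + d → Avoids0u0 d (backward x)
    backward-avoids k {d} ℓ≡ i (fᵢ , fᵢ₊ᵈ) = contradiction (trans (sym fᵢ) one) λ ()
      where
      open ≡-Reasoning
      t = (i + d) * s
      rearrange : ∀ i d k s → i * s + (k + d) * suc s ≡ k * suc s + d + (i + d) * s + 0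
      rearrange = solve-∀
      time : i * s + (k + d) * p ≡ suc (ℓ ∸ 1 + t) + 0
      time = begin
        i * s + (k + d) * p     ≡⟨ rearrange i d k s ⟩
        k * p + d + t + 0       ≡⟨ cong (λ m → m + t + 0) ℓ≡ ⟨
        ℓ + t + 0               ≡⟨ cong (λ m → m + t + 0) (suc-pred ℓ) ⟨
        suc (ℓ ∸ 1 + t) + 0     ∎
      y = traj x (ℓ ∸ 1 + t)
      one : backward x i ≡ true
      one = begin
        lookup (traj x (i * s)) (node₀ ℓ r) ≡⟨ cong (λ z → lookup z (node₀ ℓ r)) (backward-≡ (k + d) 0 time) ⟩
        lookup (F ℓ r y) (node₀ ℓ r)        ≡⟨ lookup-F-node₀ ℓ r y ⟩
        not (lookup y (node[ℓ-1] ℓ r)) ∨ lookup y (node[n-1] ℓ r)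
          ≡⟨ cong (λ b → not b ∨ lookup y (node[n-1] ℓ r))
               (trans (trajectory-along (leftNode-isPath ℓ r) x t (ℓ ∸ 1) (last ℓ) (toℕ-last ℓ)) fᵢ₊ᵈ) ⟩
        true ∎

  module _ (k : ℕ) {d q : ℕ} (1<p : 1 < p) (r≡ : r ≡ p * q) (ℓ≡ : ℓ ≡ k * p + d) where

    p≤r : p ≤ r
    p≤r = subst (p ≤_) (sym r≡) (m≤m*n p q {{m*n≢0⇒n≢0 p {{subst NonZero r≡ it}}}})

    node[n-1]-rightNode : node[n-1] ℓ r ≡ rightNode ℓ r (last r)
    node[n-1]-rightNode = toℕ-injective (trans (toℕ-fromℕ< (∸1-< (0<size ℓ r)))
      (sym (toℕ-rightNode-last ℓ r (<-≤-trans 1<p p≤r))))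

    r∸1≡s : r ∸ 1 + 1 * p ≡ s + q * p
    r∸1≡s = suc-injective (begin
      suc (r ∸ 1) + 1 * p ≡⟨ cong (_+ 1 * p) (trans (suc-pred r) r≡) ⟩
      p * q + 1 * p       ≡⟨ rearrange s q ⟩
      suc (s + q * p)     ∎)
      where
      open ≡-Reasoning
      rearrange : ∀ s q → suc s * q + 1 * suc s ≡ suc (s + q * suc s)
      rearrange = solve-∀

    s+d≡ℓ∸1 : s + d + k * p ≡ ℓ ∸ 1 + 1 * p
    s+d≡ℓ∸1 = suc-injective (begin
      suc (s + d + k * p)  ≡⟨ rearrange s d k ⟩
      k * p + d + 1 * p    ≡⟨ cong (_+ 1 * p) (trans (suc-pred ℓ) ℓ≡) ⟨
      suc (ℓ ∸ 1) + 1 * p  ∎)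
      where
      open ≡-Reasoning
      rearrange : ∀ s d k → suc (s + d + k * suc s) ≡ k * suc s + d + 1 * suc s
      rearrange = solve-∀

    module _ {f : ℕ → Bool} (periodic : Periodic p f) where

      F-node₀ : ∀ {x} → Avoids0u0 d f → Spells ℓ r f x → lookup (F ℓ r x) (node₀ ℓ r) ≡ f s
      F-node₀ {x} avoids (left , right) = begin
        lookup (F ℓ r x) (node₀ ℓ r)                              ≡⟨ lookup-F-node₀ ℓ r x ⟩
        not (lookup x (node[ℓ-1] ℓ r)) ∨ lookup x (node[n-1] ℓ r) ≡⟨ cong₂ (λ a b → not a ∨ b) leftEnd rightEnd ⟩
        not (f (s + d)) ∨ f s                                     ≡⟨ or ⟩
        f s                                                       ∎
        where
        open ≡-Reasoning
        leftEnd : lookup x (node[ℓ-1] ℓ r) ≡ f (s + d)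
        leftEnd = trans (left (last ℓ)) (trans (cong f (toℕ-last ℓ))
          (sym (periodic-≡ periodic k 1 s+d≡ℓ∸1)))
        rightEnd : lookup x (node[n-1] ℓ r) ≡ f s
        rightEnd = trans (cong (lookup x) node[n-1]-rightNode) (trans (right (last r))
          (trans (cong f (toℕ-last r)) (periodic-≡ periodic 1 q r∸1≡s)))
        or : not (f (s + d)) ∨ f s ≡ f s
        or with f s in fs | f (s + d) in fs+d
        ... | true  | b     = ∨-zeroʳ (not b)
        ... | false | true  = refl
        ... | false | false = contradiction (fs , fs+d) (avoids s)

      F-spells : ∀ {x} → Avoids0u0 d f → Spells ℓ r f x → Spells ℓ r (λ i → f (i + s)) (F ℓ r x)
      F-spells {x} avoids spells =
        F-along (leftNode-isPath ℓ r) {x = x} periodic eq (spells .onLeft) ,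
        F-along (rightNode-isPath ℓ r) {x = x} periodic eq (spells .onRight)
        where eq = F-node₀ avoids spells

    module _ {f : ℕ → Bool} (periodic : Periodic p f) where

      trajectory-spells : Avoids0u0 d f → ∀ {x} → Spells ℓ r f x → ∀ t →
        Spells ℓ r (λ i → f (i + t * s)) (traj x t)
      trajectory-spells avoids spells zero    =
        spells-cong ℓ r (λ i → cong f (sym (+-identityʳ i))) spells
      trajectory-spells avoids spells (suc t) =
        spells-cong ℓ r (λ i → cong f (+-assoc i s (t * s)))
          (F-spells
            (λ i → trans (cong f (+-swapʳ i p (t * s))) (periodic (i + t * s)))
            (λ i (fᵢ , fᵢ₊ᵈ) → avoids (i + t * s) (fᵢ , trans (cong f (+-swapʳ i (t * s) d)) fᵢ₊ᵈ))
            (trajectory-spells avoids spells t))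
        where
        +-swapʳ : ∀ a b c → a + b + c ≡ a + c + b
        +-swapʳ = solve-∀

      avoids⇒hasPeriod : Avoids0u0 d f → ∀ {x} → Spells ℓ r f x → HasPeriod ℓ r p x
      avoids⇒hasPeriod avoids {x} spells m = spells-injective ℓ r
        (spells-cong ℓ r
          (λ i → trans (cong (λ j → f (i + j)) (rearrange m s)) (periodic-* periodic (m * s) i))
          (trajectory-spells avoids spells (m * p)))
        spells
        where
        rearrange : ∀ m s → m * suc s * s ≡ m * s * suc s
        rearrange = solve-∀

    spells-unique : ∀ {f g x} → Periodic p f → Periodic p g →
      Spells ℓ r f x → Spells ℓ r g x → f ≗ g
    spells-unique {f} {g} {x} periodicᶠ periodicᵍ (_ , rightᶠ) (_ , rightᵍ) i = begin
      f i                           ≡⟨ periodic-% periodicᶠ i ⟩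
      f (i % p)                     ≡⟨ cong f (toℕ-fromℕ< i%p<r) ⟨
      f (toℕ j)                     ≡⟨ rightᶠ j ⟨
      lookup x (rightNode ℓ r j)    ≡⟨ rightᵍ j ⟩
      g (toℕ j)                     ≡⟨ cong g (toℕ-fromℕ< i%p<r) ⟩
      g (i % p)                     ≡⟨ periodic-% periodicᵍ i ⟨
      g i                           ∎
      where
      open ≡-Reasoning
      i%p<r : i % p < r
      i%p<r = <-≤-trans (m%n<n i p) p≤r
      j : Fin r
      j = fromℕ< i%p<r

    hasPeriod⇔avoids : ∀ {f x} → Periodic p f → Spells ℓ r f x →
      HasPeriod ℓ r p x ⇔ Avoids0u0 d f
    hasPeriod⇔avoids {f} {x} periodic spells = mk⇔ ⇒ λ avoids → avoids⇒hasPeriod periodic avoids spells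
      where
      ⇒ : HasPeriod ℓ r p x → Avoids0u0 d f
      ⇒ period i (fᵢ , fᵢ₊ᵈ) = backward-avoids period k ℓ≡ i
        (trans (eq i) fᵢ , trans (eq (i + d)) fᵢ₊ᵈ)
        where
        eq : backward x ≗ f
        eq = spells-unique (backward-periodic period) periodic (backward-spells period) spells

    hasPeriod⇔¬contains : ∀ (w : Vec Bool p) x → Spells ℓ r (w ‼_) x →
      HasPeriod ℓ r p x ⇔ (¬ Contains0u0 {p} d w)
    hasPeriod⇔¬contains w x spells =
      ⇔-sym (¬contains⇔avoids w) ⇔-∘ hasPeriod⇔avoids (‼-periodic w) spells

    spells-node₀-trajectory : ∀ {f x} → Periodic p f → Avoids0u0 d f → Spells ℓ r f x →
      ∀ t → t ≤ p → f (p ∸ t) ≡ lookup (traj x t) (node₀ ℓ r)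
    spells-node₀-trajectory {f} {x} periodic avoids spells t t≤p = trans
      (periodic-≡ periodic t 1 time)
      (sym (spells-node₀ ℓ r (trajectory-spells periodic avoids spells t)))
      where
      open ≡-Reasoning
      rearrange : ∀ a t s → a + t * suc s ≡ t * s + (a + t + 0)
      rearrange = solve-∀
      time : p ∸ t + t * p ≡ t * s + 1 * p
      time = trans (rearrange (p ∸ t) t s) (cong (λ m → t * s + (m + 0)) (m∸n+n≡m t≤p))

∤⇒1<p : ∀ {ℓ p} .{{_ : NonZero p}} → ¬ (p ∣ ℓ) → 1 < p
∤⇒1<p {ℓ} {1}           p∤ℓ = contradiction (1∣ ℓ) p∤ℓ
∤⇒1<p     {p = suc (suc p)} _   = s<s z<s

proposition2 : ∀ (ℓ r p q k d : ℕ) .{{_ : NonZero ℓ}} .{{_ : NonZero r}} .{{_ : NonZero p}} →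
    r ≡ p * q → ¬ (p ∣ ℓ) → d ≡ ℓ % p → ℓ ≡ k * p + d →
    (∀ (x : Config ℓ r) →
    HasPeriod ℓ r p x ⇔
    (∃[ w ] (¬ Contains0u0 {p} d w × SpelledBy ℓ r k d q w x))) ×
    (∀ (x : Config ℓ r) (w : Vec Bool p) →
    ¬ Contains0u0 d w → SpelledBy ℓ r k d q w x → ReadsNode₀ ℓ r w x) ×
    (∀ (ℓ′ r′ q′ k′ : ℕ) .{{_ : NonZero ℓ′}} .{{_ : NonZero r′}} →
    r′ ≡ p * q′ → d ≡ ℓ′ % p → ℓ′ ≡ k′ * p + d →
    (∀ (w : Vec Bool p) (x : Config ℓ r) (x′ : Config ℓ′ r′) →
    SpelledBy ℓ r k d q w x → SpelledBy ℓ′ r′ k′ d q′ w x′ →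
    HasPeriod ℓ r p x ⇔ HasPeriod ℓ′ r′ p x′) ×
    (∀ (x : Config ℓ r) → HasPeriod ℓ r p x →
    ∃[ w ] ∃[ x′ ]
    (SpelledBy ℓ r {p} k d q w x × SpelledBy ℓ′ r′ k′ d q′ w x′ ×
    HasPeriod ℓ′ r′ p x′)))
proposition2 ℓ r p@(suc s) q k d r≡ p∤ℓ d≡ ℓ≡ =
  (λ x → mk⇔ (word x) λ (w , free , spelled) → from (period⇔free w x spelled) free) ,
  (λ x w free spelled i → spells-node₀-trajectory ℓ r k 1<p r≡ ℓ≡ (‼-periodic w)
    (to (¬contains⇔avoids w) free) (to spelled⇔ spelled) (toℕ i) (<⇒≤ (toℕ<n i))) ,
  λ ℓ′ r′ q′ k′ r′≡ _ ℓ′≡ →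
    let spelled⇔′ = λ {w} {x} → spelledBy⇔spells ℓ′ r′ k′ q′ d≤p r′≡ ℓ′≡ {w} {x}
        period⇔free′ = λ w x′ spelled →
          hasPeriod⇔¬contains ℓ′ r′ k′ 1<p r′≡ ℓ′≡ w x′ (to spelled⇔′ spelled)
    in
    (λ w x x′ spelled spelled′ → ⇔-sym (period⇔free′ w x′ spelled′) ⇔-∘ period⇔free w x spelled) ,
    (λ x period →
      let w , free , spelled = word x period
          x′ , spells′ = spells-exists ℓ′ r′ (w ‼_)
          spelled′ = from spelled⇔′ spells′
      in w , x′ , spelled , spelled′ , from (period⇔free′ w x′ spelled′) free)
  where
  1<p : 1 < p
  1<p = ∤⇒1<p p∤ℓ

  d≤p : d ≤ p
  d≤p = subst (_≤ p) (sym d≡) (<⇒≤ (m%n<n ℓ p))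

  spelled⇔ : ∀ {w : Vec Bool p} {x} → SpelledBy ℓ r k d q w x ⇔ Spells ℓ r (w ‼_) x
  spelled⇔ = spelledBy⇔spells ℓ r k q d≤p r≡ ℓ≡

  period⇔free : ∀ (w : Vec Bool p) x → SpelledBy ℓ r k d q w x → HasPeriod ℓ r p x ⇔ (¬ Contains0u0 d w)
  period⇔free w x spelled = hasPeriod⇔¬contains ℓ r k 1<p r≡ ℓ≡ w x (to spelled⇔ spelled)

  word : ∀ x → HasPeriod ℓ r p x → ∃[ w ] (¬ Contains0u0 {p} d w × SpelledBy ℓ r k d q w x)
  word x period = w , to (period⇔free w x spelled) period , spelled
    where
    w = tabulate (backward ℓ r {s} x ∘ toℕ)
    spelled = from spelled⇔ (spells-cong ℓ r
      (sym ∘ tabulate-‼ (backward-periodic ℓ r period)) (backward-spells ℓ r period))
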